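{- Let $G$ be a minimum counterexample to Reed's conjecture; that is, $G$ is a graph with $\chi(G) > \left\lceil \frac{\omega(G) + \Delta(G) + 1}{2}\right\rceil$, and every graph $H$ with fewer vertices than $G$ satisfies $\chi(H) \leq \left\lceil \frac{\omega(H) + \Delta(H) + 1}{2}\right\rceil$. Then $\omega(G) < \frac{3}{4}(\Delta(G) + 1)$, and hence also $\chi(G) > \left\lceil \frac{7}{6}\omega(G) \right\rceil$.
   Context: Graphs are finite, simple and undirected. $\chi(G)$ denotes the chromatic number of $G$, $\omega(G)$ the clique number (the number of vertices in a largest clique), and $\Delta(G)$ the maximum degree. Reed's conjecture asserts that every graph $G$ satisfies $\chi(G) \leq \left\lceil \frac{\omega(G) + \Delta(G) + 1}{2}\right\rceil$. -}

module Defs where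

open import Data.Fin.Base using (Fin; funToFin; finToFun)
open import Data.Fin.Properties using (all?; any?; finToFun-funToFin)
  renaming (_≟_ to _≟ᶠ_)
open import Data.Fin.Subset using (Subset; ⊥; _∈_; ∣_∣)
open import Data.Fin.Subset.Properties using (_∈?_; ∉⊥; ∣⊥∣≡0; ∣p∣≤n; anySubset?)
open import Data.Integer.Base using (+_)
open import Data.List.Base using (allFin; map)
open import Data.List.Extrema.Nat using (max)
open import Data.Nat.Base using (ℕ; zero; suc; _+_; _≤_; _<_; _>_; ⌈_/2⌉; z≤n; s≤s; s≤s⁻¹)
open import Data.Nat.Properties using (≤∧≢⇒<)
  renaming (_≟_ to _≟ⁿ_)
open import Data.Product.Base using (∃; ∃-syntax; _×_; _,_; proj₁)
open import Data.Rational.Unnormalised.Base using (ℚᵘ; _/_)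
open import Data.Vec.Base using (tabulate)
open import Function.Base using (id; _∘_)
open import Level using (0ℓ)
open import Relation.Binary.Core using (Rel)
open import Relation.Binary.Definitions using (Symmetric)
  renaming (Decidable to Decidable₂)
open import Relation.Binary.PropositionalEquality
  using (_≡_; _≢_; refl; sym; trans)
open import Relation.Nullary using (¬_; does; yes; no; contradiction)
open import Relation.Nullary.Decidable using (map′; ¬?; _×-dec_; _→-dec_)
open import Relation.Unary using (Pred; Decidable)

-- Every finite simple graph is, up to isomorphism, one on the vertex set Fin n.
-- Adjacency is decidable, as it is classically; χ, ω and Δ are thereby
-- computable functions.
record Graph (n : ℕ) : Set₁ where
  field
    _~_      : Rel (Fin n) 0ℓ
    _~?_     : Decidable₂ _~_
    ~-sym    : Symmetric _~_
    ~-irrefl : ∀ {v} → ¬ (v ~ v)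

IsLeast : Pred ℕ 0ℓ → ℕ → Set
IsLeast P k = P k × (∀ {j} → P j → k ≤ j)

IsGreatest : Pred ℕ 0ℓ → ℕ → Set
IsGreatest P k = P k × (∀ {j} → P j → j ≤ k)

least : ∀ {P : Pred ℕ 0ℓ} → Decidable P → ∀ n → P n → ∃ (IsLeast P)
least P? zero    p = zero , p , λ _ → z≤n
least {P} P? (suc n) p with P? zero
... | yes p₀ = zero , p₀ , λ _ → z≤n
... | no ¬p₀ with least (P? ∘ suc) n p
...   | k , pk , lb = suc k , pk , lb′
  where
  lb′ : ∀ {j} → P j → suc k ≤ j
  lb′ {zero}  pj = contradiction pj ¬p₀
  lb′ {suc j} pj = s≤s (lb pj)

greatest : ∀ {P : Pred ℕ 0ℓ} → Decidable P → P 0 →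
           ∀ n → (∀ {j} → P j → j ≤ n) → ∃ (IsGreatest P)
greatest P? p₀ zero    ub = zero , p₀ , ub
greatest {P} P? p₀ (suc n) ub with P? (suc n)
... | yes p = suc n , p , ub
... | no ¬p = greatest P? p₀ n ub′
  where
  ub′ : ∀ {j} → P j → j ≤ n
  ub′ pj = s≤s⁻¹ (≤∧≢⇒< (ub pj) λ { refl → ¬p pj })

module _ {n : ℕ} (G : Graph n) where
  open Graph G

  IsProperColouring : ∀ {k} → (Fin n → Fin k) → Set
  IsProperColouring c = ∀ u v → u ~ v → c u ≢ c v

  Colourable : ℕ → Set
  Colourable k = ∃[ c ] IsProperColouring {k} c

  IsClique : Subset n → Set
  IsClique S = ∀ u v → u ∈ S → v ∈ S → u ≢ v → u ~ v

  HasClique : ℕ → Set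
  HasClique k = ∃[ S ] IsClique S × ∣ S ∣ ≡ k

  colourable? : Decidable Colourable
  colourable? k = map′
    (λ { (i , proper) → finToFun i , proper })
    (λ { (c , proper) → funToFin c , λ u v u~v eq → proper u v u~v
           (trans (sym (finToFun-funToFin c u)) (trans eq (finToFun-funToFin c v))) })
    (any? λ i → all? λ u → all? λ v →
      (u ~? v) →-dec ¬? (finToFun i u ≟ᶠ finToFun i v))

  n-colourable : Colourable n
  n-colourable = id , λ { u .u u~u refl → ~-irrefl u~u }

  isClique? : Decidable IsClique
  isClique? S = all? λ u → all? λ v →
    (u ∈? S) →-dec ((v ∈? S) →-dec (¬? (u ≟ᶠ v) →-dec (u ~? v)))

  hasClique? : Decidable HasClique
  hasClique? k = anySubset? λ S → isClique? S ×-dec (∣ S ∣ ≟ⁿ k)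

  chromatic : ∃ (IsLeast Colourable)
  chromatic = least colourable? n n-colourable

  clique : ∃ (IsGreatest HasClique)
  clique = greatest hasClique?
    (⊥ , (λ u v u∈⊥ → contradiction u∈⊥ ∉⊥) , ∣⊥∣≡0 n)
    n (λ { (S , _ , refl) → ∣p∣≤n S })

  χ : ℕ
  χ = proj₁ chromatic

  ω : ℕ
  ω = proj₁ clique

  neighbours : Fin n → Subset n
  neighbours v = tabulate λ u → does (v ~? u)

  degree : Fin n → ℕ
  degree v = ∣ neighbours v ∣

  -- The default value 0 matters only for the graph without vertices.
  Δ : ℕ
  Δ = max 0 (map degree (allFin n))

  reedBound : ℕ
  reedBound = ⌈ ω + Δ + 1 /2⌉

IsMinimumCounterexample : ∀ {n} → Graph n → Set₁
IsMinimumCounterexample {n} G =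
  χ G > reedBound G × (∀ {m} → m < n → (H : Graph m) → χ H ≤ reedBound H)

toℚᵘ : ℕ → ℚᵘ
toℚᵘ k = + k / 1

{-# OPTIONS --safe #-}
module Submission where

-- The idea is to hit every maximum clique with one independent set.
--
-- Suppose 4 ω ≥ 3 (Δ + 1). Call a clique of ω vertices maximum. Two maximum
-- cliques with a common vertex v lie in the closed neighbourhood of v, so they
-- share at least 2 ω - (Δ + 1) vertices, which is more than ω / 2. Fix a
-- maximum clique Q and let D and F be the intersection and the union of Q and
-- the maximum cliques meeting Q. Hajnal's inequality |D| + |F| ≥ 2 ω holds, and
-- adding the cliques one at a time keeps D nonempty, by Kostochka's argument:
-- the intersection so far and the trace of the next clique on Q both fill more
-- than half of Q. As D is nonempty, |F| ≤ Δ + 1, whence |D| ≥ 2 ω - (Δ + 1).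
-- This is "kernel".
--
-- Choose a maximal family of pairwise disjoint maximum cliques Q i; every
-- maximum clique meets some Q i and then contains the core D i. A vertex of D i
-- has at most Δ + 1 - ω neighbours with which it shares no maximum clique, and
-- |D i| ≥ 2 (Δ + 1 - ω). Haxell's theorem ("haxell") gives vertices t i of D i,
-- no two of which are adjacent without sharing a maximum clique. Vertices of
-- distinct cores never share one, so the t i form an independent set hitting
-- every maximum clique ("independent-hitting").
--
-- Extend this set to a maximal independent set M. If G has an edge, deleting M
-- lowers ω and Δ by at least one each and χ by at most one, so Reed's bound passes
-- from G - M to G ("reed-step"). A minimum counterexample therefore has 4 ω < 3 (Δ + 1), and
-- the bound on χ follows by arithmetic.

open import Defs
open import Data.Fin.Base using (Fin; zero; suc)
open import Data.Fin.Properties using (any?) renaming (_≟_ to _≟ᶠ_; suc-injective to sucᶠ-injective)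
open import Data.Fin.Subset using (Subset; Nonempty; Empty; inside; outside; ⊥; _∈_; _∉_; _⊆_;
  _∪_; _∩_; ⁅_⁆; ∣_∣; ∁)
open import Data.Fin.Subset.Properties
open import Data.List.Base using (List; []; _∷_; _++_; map; filter; allFin)
open import Data.List.Extrema.Nat using (xs≤max; max≤v⁺)
open import Data.List.Membership.Propositional using () renaming (_∈_ to _∈ˡ_)
open import Data.List.Membership.Propositional.Properties
  using (∈-map⁺; ∈-++⁺ˡ; ∈-++⁺ʳ; ∈-filter⁺; ∈-filter⁻; ∈-allFin)
open import Data.List.Relation.Unary.All as All using (All; []; _∷_)
import Data.List.Relation.Unary.All.Properties as All
open import Data.List.Relation.Unary.Any using (here; there)
open import Data.Nat.Base using (ℕ; zero; suc; _+_; _*_; _∸_; _⊔_; _≤_; _<_; z≤n; s≤s; s≤s⁻¹; ⌈_/2⌉)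
open import Data.Nat.Properties renaming (_≟_ to _≟ⁿ_)
open import Data.Nat.Tactic.RingSolver using (solve-∀)
open import Data.Product.Base using (∃-syntax; _×_; _,_; proj₁; proj₂)
open import Data.Sum.Base using (_⊎_; inj₁; inj₂)
open import Data.Vec.Base using ([]; _∷_; here; there; tabulate)
open import Data.Vec.Functional using (updateAt)
open import Data.Vec.Functional.Properties using (updateAt-updates; updateAt-minimal)
open import Data.Vec.Properties using ([]=⇒lookup; lookup⇒[]=; lookup∘tabulate)
open import Function.Base using (_∘_; const)
open import Relation.Binary.PropositionalEquality
open import Relation.Nullary using (Dec; ¬_; does; yes; no; contradiction)
open import Relation.Nullary.Decidable using (dec-true; ¬?; _×-dec_)

private
  variable
    n r : ℕ

-- Finite subsets and unions of families

-- The set of all points satisfying a decidable predicate.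
select : ∀ {P : Fin n → Set} → (∀ x → Dec (P x)) → Subset n
select P? = tabulate (does ∘ P?)

module _ {P : Fin n → Set} (P? : ∀ x → Dec (P x)) where

  ∈-select⁺ : ∀ {x} → P x → x ∈ select P?
  ∈-select⁺ {x} px = lookup⇒[]= x _ (trans (lookup∘tabulate (does ∘ P?) x) (dec-true (P? x) px))

  ∈-select⁻ : ∀ {x} → x ∈ select P? → P x
  ∈-select⁻ {x} x∈ with P? x | trans (sym (lookup∘tabulate (does ∘ P?) x)) ([]=⇒lookup x∈)
  ... | yes px | _ = px
  ... | no  _  | ()

∣p∪q∣+∣p∩q∣≡∣p∣+∣q∣ : ∀ (p q : Subset n) → ∣ p ∪ q ∣ + ∣ p ∩ q ∣ ≡ ∣ p ∣ + ∣ q ∣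
∣p∪q∣+∣p∩q∣≡∣p∣+∣q∣ []            []            = refl
∣p∪q∣+∣p∩q∣≡∣p∣+∣q∣ (outside ∷ p) (outside ∷ q) = ∣p∪q∣+∣p∩q∣≡∣p∣+∣q∣ p q
∣p∪q∣+∣p∩q∣≡∣p∣+∣q∣ (inside  ∷ p) (outside ∷ q) = cong suc (∣p∪q∣+∣p∩q∣≡∣p∣+∣q∣ p q)
∣p∪q∣+∣p∩q∣≡∣p∣+∣q∣ (outside ∷ p) (inside  ∷ q) =
  trans (cong suc (∣p∪q∣+∣p∩q∣≡∣p∣+∣q∣ p q)) (sym (+-suc ∣ p ∣ ∣ q ∣))
∣p∪q∣+∣p∩q∣≡∣p∣+∣q∣ (inside  ∷ p) (inside  ∷ q) = cong suc
  (trans (+-suc ∣ p ∪ q ∣ ∣ p ∩ q ∣)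
    (trans (cong suc (∣p∪q∣+∣p∩q∣≡∣p∣+∣q∣ p q)) (sym (+-suc ∣ p ∣ ∣ q ∣))))

∣p∪q∣≤∣p∣+∣q∣ : ∀ (p q : Subset n) → ∣ p ∪ q ∣ ≤ ∣ p ∣ + ∣ q ∣
∣p∪q∣≤∣p∣+∣q∣ p q = ≤-trans (m≤m+n _ _) (≤-reflexive (∣p∪q∣+∣p∩q∣≡∣p∣+∣q∣ p q))

Empty⇒∣p∣≡0 : ∀ {p : Subset n} → Empty p → ∣ p ∣ ≡ 0
Empty⇒∣p∣≡0 {n = n} ep = trans (cong ∣_∣ (Empty-unique ep)) (∣⊥∣≡0 n)

0<∣p∣⇒Nonempty : ∀ {p : Subset n} → 0 < ∣ p ∣ → Nonempty p
0<∣p∣⇒Nonempty {p = p} 0<p with nonempty? p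
... | yes ne = ne
... | no  ep = contradiction (Empty⇒∣p∣≡0 ep) (>⇒≢ 0<p)

x∈p⇒0<∣p∣ : ∀ {p : Subset n} {x} → x ∈ p → 0 < ∣ p ∣
x∈p⇒0<∣p∣ here                  = s≤s z≤n
x∈p⇒0<∣p∣ {p = s ∷ p} (there x∈p) = ≤-trans (x∈p⇒0<∣p∣ x∈p) (∣p∣≤∣x∷p∣ s p)

∣p∪q∣≡∣p∣+∣q∣ : ∀ (p q : Subset n) → Empty (p ∩ q) → ∣ p ∪ q ∣ ≡ ∣ p ∣ + ∣ q ∣
∣p∪q∣≡∣p∣+∣q∣ p q disj = begin
  ∣ p ∪ q ∣                ≡⟨ +-identityʳ _ ⟨
  ∣ p ∪ q ∣ + 0            ≡⟨ cong (∣ p ∪ q ∣ +_) (Empty⇒∣p∣≡0 disj) ⟨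
  ∣ p ∪ q ∣ + ∣ p ∩ q ∣    ≡⟨ ∣p∪q∣+∣p∩q∣≡∣p∣+∣q∣ p q ⟩
  ∣ p ∣ + ∣ q ∣            ∎
  where open ≡-Reasoning

∣q∣<∣p∣⇒p⊈q : ∀ {p q : Subset n} → ∣ q ∣ < ∣ p ∣ → ∃[ x ] x ∈ p × x ∉ q
∣q∣<∣p∣⇒p⊈q {p = p} {q} q<p with any? (λ x → (x ∈? p) ×-dec ¬? (x ∈? q))
... | yes found = found
... | no  none  = contradiction (p⊆q⇒∣p∣≤∣q∣ p⊆q) (<⇒≱ q<p)
  where
  p⊆q : p ⊆ q
  p⊆q {x} x∈p with x ∈? q
  ... | yes x∈q = x∈q
  ... | no  x∉q = contradiction (x , x∈p , x∉q) none

-- The union of the sets f i over the indices i in W.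
⋃[_] : Subset r → (Fin r → Subset n) → Subset n
⋃[ []          ] f = ⊥
⋃[ inside  ∷ W ] f = f zero ∪ ⋃[ W ] (f ∘ suc)
⋃[ outside ∷ W ] f = ⋃[ W ] (f ∘ suc)

∈-⋃⁺ : ∀ {W : Subset r} (f : Fin r → Subset n) {i x} → i ∈ W → x ∈ f i → x ∈ ⋃[ W ] f
∈-⋃⁺ {W = inside  ∷ W} f here        x∈ = x∈p∪q⁺ (inj₁ x∈)
∈-⋃⁺ {W = inside  ∷ W} f (there i∈W) x∈ = x∈p∪q⁺ (inj₂ (∈-⋃⁺ (f ∘ suc) i∈W x∈))
∈-⋃⁺ {W = outside ∷ W} f (there i∈W) x∈ = ∈-⋃⁺ (f ∘ suc) i∈W x∈

∈-⋃⁻ : ∀ (W : Subset r) (f : Fin r → Subset n) {x} → x ∈ ⋃[ W ] f → ∃[ i ] i ∈ W × x ∈ f i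
∈-⋃⁻ []            f x∈ = contradiction x∈ ∉⊥
∈-⋃⁻ (outside ∷ W) f x∈ with ∈-⋃⁻ W (f ∘ suc) x∈
... | i , i∈W , x∈fi = suc i , there i∈W , x∈fi
∈-⋃⁻ (inside ∷ W)  f x∈ with x∈p∪q⁻ (f zero) _ x∈
... | inj₁ x∈f0 = zero , here , x∈f0
... | inj₂ x∈′ with ∈-⋃⁻ W (f ∘ suc) x∈′
...   | i , i∈W , x∈fi = suc i , there i∈W , x∈fi

∣⋃∣≤ : ∀ (W : Subset r) (f : Fin r → Subset n) {d} →
       (∀ {i} → i ∈ W → ∣ f i ∣ ≤ d) → ∣ ⋃[ W ] f ∣ ≤ ∣ W ∣ * d
∣⋃∣≤ {n = n} [] f small = ≤-reflexive (∣⊥∣≡0 n)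
∣⋃∣≤ (outside ∷ W) f small = ∣⋃∣≤ W (f ∘ suc) (small ∘ there)
∣⋃∣≤ (inside  ∷ W) f small =
  ≤-trans (∣p∪q∣≤∣p∣+∣q∣ (f zero) _)
          (+-mono-≤ (small here) (∣⋃∣≤ W (f ∘ suc) (small ∘ there)))

-- Sets with distinct indices are disjoint; stated so that equal nonempty
-- members are excluded as well.
PairwiseDisjoint : (Fin r → Subset n) → Set
PairwiseDisjoint f = ∀ {i j x} → x ∈ f i → x ∈ f j → i ≡ j

≤∣⋃∣ : ∀ (W : Subset r) (f : Fin r → Subset n) {m} → PairwiseDisjoint f →
       (∀ i → m ≤ ∣ f i ∣) → ∣ W ∣ * m ≤ ∣ ⋃[ W ] f ∣
≤∣⋃∣ []            f disj large = z≤n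
≤∣⋃∣ (outside ∷ W) f disj large =
  ≤∣⋃∣ W (f ∘ suc) (λ x∈ y∈ → sucᶠ-injective (disj x∈ y∈)) (large ∘ suc)
≤∣⋃∣ (inside  ∷ W) f {m} disj large = begin
  m + ∣ W ∣ * m                     ≤⟨ +-mono-≤ (large zero) (≤∣⋃∣ W (f ∘ suc)
                                        (λ x∈ y∈ → sucᶠ-injective (disj x∈ y∈)) (large ∘ suc)) ⟩
  ∣ f zero ∣ + ∣ ⋃[ W ] (f ∘ suc) ∣ ≡⟨ ∣p∪q∣≡∣p∣+∣q∣ (f zero) _ separate ⟨
  ∣ f zero ∪ ⋃[ W ] (f ∘ suc) ∣     ∎
  where
  open ≤-Reasoning
  separate : Empty (f zero ∩ ⋃[ W ] (f ∘ suc))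
  separate (x , x∈) with x∈p∩q⁻ (f zero) _ x∈
  ... | x∈f0 , x∈⋃ with ∈-⋃⁻ W (f ∘ suc) x∈⋃
  ...   | i , _ , x∈fi with disj {zero} {suc i} x∈f0 x∈fi
  ...     | ()

-- Independent transversals

-- The relation is only required to be symmetric; irreflexivity plays no role,
-- since transversals compare vertices with distinct indices.
module Transversals {n : ℕ} {_~_ : Fin n → Fin n → Set}
  (_~?_ : ∀ u v → Dec (u ~ v)) (~-sym : ∀ {u v} → u ~ v → v ~ u) where

  -- The neighbourhood of v.
  nbrs : Fin n → Subset n
  nbrs v = select (v ~?_)

  -- An independent transversal: one vertex from each set, pairwise unrelated.
  IsIT : (Fin r → Subset n) → (Fin r → Fin n) → Set
  IsIT V t = (∀ i → t i ∈ V i) × (∀ {i j} → i ≢ j → ¬ (t i ~ t j))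

  -- No member of X is a neighbour of y.
  Free : Subset n → Fin n → Set
  Free X y = ∀ {x} → x ∈ X → ¬ (x ~ y)

  -- The inductive step of Haxell's theorem. A transversal t of all the sets but
  -- V zero is given, and one of all the sets is wanted. The search grows a set X of
  -- vertices and a set W of indices, W containing every j such that t j has a
  -- neighbour in X, with |X| at most |W|. The vertices of X and the t j with j in W
  -- number at most 2 |W| and so dominate at most 2 d |W| vertices, too few for the
  -- 1 + |W| sets indexed by zero and W. Hence some x in one of those sets is
  -- undominated. If x has no neighbour t j, it can be put into the transversal.
  -- Otherwise x joins X and the indices of its neighbours join W. Replacing t i,
  -- for i in W, by an undominated vertex removes a neighbour of some member of X,
  -- and the search resumes from there.
  module Augment {r : ℕ} (V : Fin (suc r) → Subset n) (disjoint : PairwiseDisjoint V)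
    (d : ℕ) (sparse : ∀ {i x} → x ∈ V i → ∣ nbrs x ∣ ≤ d)
    (large : ∀ i → d + d ≤ ∣ V i ∣) (inhabited : ∀ i → Nonempty (V i)) where

    -- The sets already covered; index i of V⁺ is index suc i of V.
    V⁺ : Fin r → Subset n
    V⁺ = V ∘ suc

    -- The indices j for which t j is a neighbour of x.
    hits : (Fin r → Fin n) → Fin n → Subset r
    hits t x = select (λ j → x ~? t j)

    -- Every vertex that changes becomes one without neighbours in X, so that no
    -- member of X gains a neighbour in the transversal.
    Evolves : Subset n → (t t′ : Fin r → Fin n) → Set
    Evolves X t t′ = ∀ j → t′ j ≡ t j ⊎ Free X (t′ j)

    evolves-trans : ∀ {X t t′ t″} → Evolves X t t′ → Evolves X t′ t″ → Evolves X t t″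
    evolves-trans {X} e e′ j with e′ j
    ... | inj₂ free = inj₂ free
    ... | inj₁ eq with e j
    ...   | inj₁ eq′  = inj₁ (trans eq eq′)
    ...   | inj₂ free = inj₂ (subst (Free X) (sym eq) free)

    -- The transversal can evolve so that its vertex at some index of W has no
    -- neighbour in X.
    Released : (Fin r → Fin n) → Subset n → Subset r → Set
    Released t X W =
      ∃[ t′ ] IsIT V⁺ t′ × Evolves X t t′ × ∃[ i ] i ∈ W × Free X (t′ i)

    -- The invariant of the search.
    record State (t : Fin r → Fin n) (X : Subset n) (W : Subset r) : Set where
      field
        transversal : IsIT V⁺ t
        live        : ∀ {x} → x ∈ X → ∃[ i ] x ∈ V i
        few         : ∣ X ∣ ≤ ∣ W ∣
        covered     : ∀ {x j} → x ∈ X → x ~ t j → j ∈ W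

    open State

    -- x is adjacent neither to a member of X nor to a t j with j in W.
    record Undominated (t : Fin r → Fin n) (X : Subset n) (W : Subset r) (x : Fin n) : Set where
      field
        avoidsX : Free X x
        avoidsW : ∀ {j} → j ∈ W → ¬ (t j ~ x)

    open Undominated

    undominated : ∀ {t X W} → State t X W →
                  ∃[ s ] s ∈ inside ∷ W × ∃[ x ] x ∈ V s × Undominated t X W x
    undominated {t} {X} {W} st
      with ∣q∣<∣p∣⇒p⊈q {p = ⋃[ inside ∷ W ] V} {⋃[ X ] nbrs ∪ ⋃[ W ] (nbrs ∘ t)} bound
      where
      -- The maximum with 1 covers the case d = 0, where the sets are merely nonempty.
      m : ℕ
      m = 1 ⊔ (d + d)
      open ≤-Reasoning
      bound : ∣ ⋃[ X ] nbrs ∪ ⋃[ W ] (nbrs ∘ t) ∣ < ∣ ⋃[ inside ∷ W ] V ∣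
      bound = begin-strict
        ∣ ⋃[ X ] nbrs ∪ ⋃[ W ] (nbrs ∘ t) ∣     ≤⟨ ∣p∪q∣≤∣p∣+∣q∣ (⋃[ X ] nbrs) _ ⟩
        ∣ ⋃[ X ] nbrs ∣ + ∣ ⋃[ W ] (nbrs ∘ t) ∣
          ≤⟨ +-mono-≤ (∣⋃∣≤ X nbrs (λ x∈X → sparse (proj₂ (live st x∈X))))
                      (∣⋃∣≤ W (nbrs ∘ t) (λ {i} _ → sparse (proj₁ (transversal st) i))) ⟩
        ∣ X ∣ * d + ∣ W ∣ * d                   ≤⟨ +-monoˡ-≤ _ (*-monoˡ-≤ d (few st)) ⟩
        ∣ W ∣ * d + ∣ W ∣ * d                   ≡⟨ *-distribˡ-+ ∣ W ∣ d d ⟨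
        ∣ W ∣ * (d + d)                         ≤⟨ *-monoʳ-≤ ∣ W ∣ (m≤n⊔m 1 (d + d)) ⟩
        ∣ W ∣ * m                               <⟨ +-monoˡ-< (∣ W ∣ * m) (m≤m⊔n 1 (d + d)) ⟩
        m + ∣ W ∣ * m                           ≤⟨ ≤∣⋃∣ (inside ∷ W) V disjoint
                                                    (λ i → ⊔-lub (x∈p⇒0<∣p∣ (proj₂ (inhabited i))) (large i)) ⟩
        ∣ ⋃[ inside ∷ W ] V ∣                   ∎
    ... | x , x∈ , x∉ with ∈-⋃⁻ (inside ∷ W) V x∈
    ...   | s , s∈ , x∈Vs = s , s∈ , x , x∈Vs , record
      { avoidsX = λ {y} y∈X y~x →
          x∉ (x∈p∪q⁺ (inj₁ (∈-⋃⁺ nbrs y∈X (∈-select⁺ (y ~?_) y~x))))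
      ; avoidsW = λ {j} j∈W tj~x →
          x∉ (x∈p∪q⁺ (inj₂ (∈-⋃⁺ (nbrs ∘ t) j∈W (∈-select⁺ (t j ~?_) tj~x))))
      }

    -- The transversal wanted.
    Full : Set
    Full = ∃[ t ] IsIT V t

    -- An undominated vertex without neighbours in the transversal either fills
    -- the missing place zero or replaces the vertex at an index of W.
    insert : ∀ {t X W s x} → State t X W → s ∈ inside ∷ W → x ∈ V s →
             Undominated t X W x → Empty (hits t x) → Full ⊎ Released t X W
    insert {t} {s = zero} {x} st here x∈V und none = inj₁ (t⁺ , t⁺∈V , t⁺-indep)
      where
      t⁺ : Fin (suc r) → Fin n
      t⁺ zero    = x
      t⁺ (suc i) = t i
      t⁺∈V : ∀ i → t⁺ i ∈ V i
      t⁺∈V zero    = x∈V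
      t⁺∈V (suc i) = proj₁ (transversal st) i
      t⁺-indep : ∀ {i j} → i ≢ j → ¬ (t⁺ i ~ t⁺ j)
      t⁺-indep {zero}  {zero}  i≢j _   = i≢j refl
      t⁺-indep {zero}  {suc j} _   x~t = none (j , ∈-select⁺ (λ j → x ~? t j) x~t)
      t⁺-indep {suc i} {zero}  _   t~x = none (i , ∈-select⁺ (λ j → x ~? t j) (~-sym t~x))
      t⁺-indep {suc i} {suc j} i≢j     = proj₂ (transversal st) (i≢j ∘ cong suc)
    insert {t} {X} {W} {suc i} {x} st (there i∈W) x∈V und none =
      inj₂ (t′ , (t′∈V , t′-indep) , evolves , i , i∈W ,
            subst (Free X) (sym t′i≡x) (avoidsX und))
      where
      t′ : Fin r → Fin n
      t′ = updateAt t i (const x)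
      t′i≡x : t′ i ≡ x
      t′i≡x = updateAt-updates i t
      t′j≡tj : ∀ {j} → j ≢ i → t′ j ≡ t j
      t′j≡tj {j} j≢i = updateAt-minimal j i t j≢i
      t′∈V : ∀ j → t′ j ∈ V⁺ j
      t′∈V j with j ≟ᶠ i
      ... | yes refl = subst (_∈ V⁺ i) (sym t′i≡x) x∈V
      ... | no  j≢i  = subst (_∈ V⁺ j) (sym (t′j≡tj j≢i)) (proj₁ (transversal st) j)
      x≁t : ∀ j → ¬ (x ~ t j)
      x≁t j x~t = none (j , ∈-select⁺ (λ j → x ~? t j) x~t)
      t′-indep : ∀ {j k} → j ≢ k → ¬ (t′ j ~ t′ k)
      t′-indep {j} {k} j≢k with j ≟ᶠ i | k ≟ᶠ i
      ... | yes refl | yes refl = contradiction refl j≢k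
      ... | yes refl | no  k≢i  = λ e → x≁t k (subst₂ _~_ t′i≡x (t′j≡tj k≢i) e)
      ... | no  j≢i  | yes refl = λ e → x≁t j (~-sym (subst₂ _~_ (t′j≡tj j≢i) t′i≡x e))
      ... | no  j≢i  | no  k≢i  = λ e →
        proj₂ (transversal st) j≢k (subst₂ _~_ (t′j≡tj j≢i) (t′j≡tj k≢i) e)
      evolves : Evolves X t t′
      evolves j with j ≟ᶠ i
      ... | yes refl = inj₂ (subst (Free X) (sym t′i≡x) (avoidsX und))
      ... | no  j≢i  = inj₁ (t′j≡tj j≢i)

    -- The fuel bounds the number of times W can still grow. For a fixed
    -- undominated x, the search recurs on the number of neighbours of x in the
    -- transversal.
    search : ∀ fuel {t X W} → State t X W → r < fuel + ∣ W ∣ → Full ⊎ Released t X W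
    search-from : ∀ fuel k {t X W s x} → State t X W → r < suc fuel + ∣ W ∣ →
                  s ∈ inside ∷ W → x ∈ V s → Undominated t X W x →
                  ∣ hits t x ∣ ≤ k → Full ⊎ Released t X W

    search zero {W = W} st r<W = contradiction (∣p∣≤n W) (<⇒≱ r<W)
    search (suc fuel) st r<W with undominated st
    ... | s , s∈ , x , x∈V , und = search-from fuel _ st r<W s∈ x∈V und ≤-refl

    search-from fuel k {t} {X} {W} {s} {x} st r<W s∈ x∈V und hits≤k
      with nonempty? (hits t x)
    ... | no  none       = insert st s∈ x∈V und none
    ... | yes (i₀ , i₀∈) = continue (search fuel st′ r<W′)
      where
      X′ : Subset n
      X′ = X ∪ ⁅ x ⁆
      W′ : Subset r
      W′ = W ∪ hits t x

      x∈X′ : x ∈ X′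
      x∈X′ = x∈p∪q⁺ (inj₂ (x∈⁅x⁆ x))

      i₀∉W : i₀ ∉ W
      i₀∉W i₀∈W = avoidsW und i₀∈W (~-sym (∈-select⁻ (λ j → x ~? t j) i₀∈))

      W<W′ : ∣ W ∣ < ∣ W′ ∣
      W<W′ = p⊂q⇒∣p∣<∣q∣ (p⊆p∪q (hits t x) , i₀ , x∈p∪q⁺ (inj₂ i₀∈) , i₀∉W)

      r<W′ : r < fuel + ∣ W′ ∣
      r<W′ = ≤-trans r<W (≤-trans (≤-reflexive (sym (+-suc fuel ∣ W ∣))) (+-monoʳ-≤ fuel W<W′))

      st′ : State t X′ W′
      st′ = record
        { transversal = transversal st
        ; live = live′
        ; few = begin
            ∣ X ∪ ⁅ x ⁆ ∣     ≤⟨ ∣p∪q∣≤∣p∣+∣q∣ X ⁅ x ⁆ ⟩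
            ∣ X ∣ + ∣ ⁅ x ⁆ ∣ ≡⟨ cong (∣ X ∣ +_) (∣⁅x⁆∣≡1 x) ⟩
            ∣ X ∣ + 1         ≡⟨ +-comm ∣ X ∣ 1 ⟩
            suc ∣ X ∣         ≤⟨ s≤s (few st) ⟩
            suc ∣ W ∣         ≤⟨ W<W′ ⟩
            ∣ W′ ∣            ∎
        ; covered = covered′
        }
        where
        open ≤-Reasoning
        live′ : ∀ {y} → y ∈ X′ → ∃[ i ] y ∈ V i
        live′ y∈ with x∈p∪q⁻ X ⁅ x ⁆ y∈
        ... | inj₁ y∈X = live st y∈X
        ... | inj₂ y∈x with x∈⁅y⁆⇒x≡y x y∈x
        ...   | refl = s , x∈V
        covered′ : ∀ {y j} → y ∈ X′ → y ~ t j → j ∈ W′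
        covered′ y∈ y~t with x∈p∪q⁻ X ⁅ x ⁆ y∈
        ... | inj₁ y∈X = x∈p∪q⁺ (inj₁ (covered st y∈X y~t))
        ... | inj₂ y∈x with x∈⁅y⁆⇒x≡y x y∈x
        ...   | refl = x∈p∪q⁺ (inj₂ (∈-select⁺ (λ j → x ~? t j) y~t))

      continue : Full ⊎ Released t X′ W′ → Full ⊎ Released t X W
      continue (inj₁ full) = inj₁ full
      continue (inj₂ (t′ , it′ , ev′ , i , i∈W′ , free)) = by-origin (i ∈? W)
        where
        ev : Evolves X t t′
        ev j with ev′ j
        ... | inj₁ eq = inj₁ eq
        ... | inj₂ f  = inj₂ (f ∘ p⊆p∪q ⁅ x ⁆)

        new⇒old : ∀ {y j} → y ∈ X′ → y ~ t′ j → y ~ t j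
        new⇒old {j = j} y∈ y~ with ev′ j
        ... | inj₁ eq = subst (_ ~_) eq y~
        ... | inj₂ f  = contradiction y~ (f y∈)

        fewer : i ∉ W → ∣ hits t′ x ∣ < ∣ hits t x ∣
        fewer i∉W = p⊂q⇒∣p∣<∣q∣
          ( (λ {j} j∈ → ∈-select⁺ (λ j → x ~? t j)
                          (new⇒old x∈X′ (∈-select⁻ (λ j → x ~? t′ j) j∈)))
          , i , i∈hits , λ i∈ → free x∈X′ (∈-select⁻ (λ j → x ~? t′ j) i∈))
          where
          i∈hits : i ∈ hits t x
          i∈hits with x∈p∪q⁻ W (hits t x) i∈W′
          ... | inj₁ i∈W = contradiction i∈W i∉W
          ... | inj₂ i∈h = i∈h

        st″ : State t′ X W
        st″ = record
          { transversal = it′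
          ; live        = live st
          ; few         = few st
          ; covered     = λ y∈X y~ → covered st y∈X (new⇒old (p⊆p∪q ⁅ x ⁆ y∈X) y~)
          }

        und′ : Undominated t′ X W x
        und′ = record
          { avoidsX = avoidsX und
          ; avoidsW = λ j∈W t′j~x →
              avoidsW und j∈W (~-sym (new⇒old x∈X′ (~-sym t′j~x)))
          }

        retry : ∀ k → ∣ hits t x ∣ ≤ k → i ∉ W → Full ⊎ Released t X W
        retry zero    hits≤0 i∉W = contradiction (≤-trans (fewer i∉W) hits≤0) n≮0
        retry (suc k) hits≤k i∉W
          with search-from fuel k st″ r<W s∈ x∈V und′ (s≤s⁻¹ (≤-trans (fewer i∉W) hits≤k))
        ... | inj₁ full = inj₁ full
        ... | inj₂ (t″ , it″ , ev″ , released) =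
          inj₂ (t″ , it″ , evolves-trans {X} {t} {t′} {t″} ev ev″ , released)

        -- An index already in W is passed on; otherwise x has lost the neighbour t i.
        by-origin : Dec (i ∈ W) → Full ⊎ Released t X W
        by-origin (yes i∈W) = inj₂ (t′ , it′ , ev , i , i∈W , free ∘ p⊆p∪q ⁅ x ⁆)
        by-origin (no  i∉W) = retry k hits≤k i∉W

    augment : ∃[ t ] IsIT V⁺ t → Full
    augment (t , it) with search (suc r) {t} {⊥} {⊥} start (m≤m+n (suc r) _)
      where
      start : State t ⊥ ⊥
      start = record
        { transversal = it
        ; live        = λ x∈⊥ → contradiction x∈⊥ ∉⊥
        ; few         = ≤-reflexive (trans (∣⊥∣≡0 n) (sym (∣⊥∣≡0 r)))
        ; covered     = λ x∈⊥ → contradiction x∈⊥ ∉⊥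
        }
    ... | inj₁ full = full
    ... | inj₂ (_ , _ , _ , i , i∈⊥ , _) = contradiction i∈⊥ ∉⊥

  -- Haxell's theorem: sets of at least 2 d vertices, each vertex having at most d
  -- neighbours, have an independent transversal. Nonemptiness is asked for
  -- separately, for the sake of d = 0.
  haxell : ∀ {r} (V : Fin r → Subset n) → PairwiseDisjoint V →
           ∀ d → (∀ {i x} → x ∈ V i → ∣ nbrs x ∣ ≤ d) →
           (∀ i → d + d ≤ ∣ V i ∣) → (∀ i → Nonempty (V i)) → ∃[ t ] IsIT V t
  haxell {zero}  V disj d sparse large inh = (λ ()) , (λ ()) , λ { {()} }
  haxell {suc r} V disj d sparse large inh =
    Augment.augment V disj d sparse large inh
      (haxell (V ∘ suc) (λ x∈ y∈ → sucᶠ-injective (disj x∈ y∈)) d sparse (large ∘ suc) (inh ∘ suc))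

-- Numerical inequalities, with w for ω and s for Δ + 1

-- In terms of the sets in the inductive step of Hajnal's inequality, d = |D|,
-- f = |F|, a = |A ∩ F|, b = |A ∩ D| and u = |A ∪ F|.
hajnal-arithmetic : ∀ w d f a b u → a + d ≤ w + b → u + a ≡ w + f → w + w ≤ d + f → w + w ≤ b + u
hajnal-arithmetic w d f a b u h₁ h₂ h₃ = +-cancelʳ-≤ (a + w) _ _ (begin
  w + w + (a + w)   ≤⟨ +-monoˡ-≤ (a + w) h₃ ⟩
  d + f + (a + w)   ≡⟨ e₁ d f a w ⟩
  a + d + (w + f)   ≡⟨ cong (a + d +_) h₂ ⟨
  a + d + (u + a)   ≤⟨ +-monoˡ-≤ (u + a) h₁ ⟩
  w + b + (u + a)   ≡⟨ e₂ w b u a ⟩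
  b + u + (a + w)   ∎)
  where
  open ≤-Reasoning
  e₁ : ∀ d f a w → d + f + (a + w) ≡ a + d + (w + f)
  e₁ = solve-∀
  e₂ : ∀ w b u a → w + b + (u + a) ≡ b + u + (a + w)
  e₂ = solve-∀

-- Sets of a and b points inside a set of w points, each of size at least
-- 2 w - s, have c > 0 common points.
overlap-arithmetic : ∀ w s a b c → 0 < s → 3 * s ≤ 4 * w →
  w + w ≤ a + s → w + w ≤ b + s → a + b ≤ w + c → 0 < c
overlap-arithmetic w s a b zero    0<s h ha hb hab = contradiction s≤0 (<⇒≱ 0<s)
  where
  open ≤-Reasoning
  e₁ : ∀ w → w + w + (w + w) ≡ 3 * w + w
  e₁ = solve-∀
  e₂ : ∀ a b s → a + s + (b + s) ≡ a + b + 2 * s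
  e₂ = solve-∀
  e₃ : ∀ w s → w + 0 + 2 * s ≡ 2 * s + w
  e₃ = solve-∀
  e₄ : ∀ s → s + 8 * s ≡ 3 * (3 * s)
  e₄ = solve-∀
  e₅ : ∀ w → 3 * (4 * w) ≡ 4 * (3 * w)
  e₅ = solve-∀
  e₆ : ∀ s → 4 * (2 * s) ≡ 0 + 8 * s
  e₆ = solve-∀
  3w≤2s : 3 * w ≤ 2 * s
  3w≤2s = +-cancelʳ-≤ w _ _ (begin
    3 * w + w         ≡⟨ e₁ w ⟨
    w + w + (w + w)   ≤⟨ +-mono-≤ ha hb ⟩
    a + s + (b + s)   ≡⟨ e₂ a b s ⟩
    a + b + 2 * s     ≤⟨ +-monoˡ-≤ (2 * s) hab ⟩
    w + 0 + 2 * s     ≡⟨ e₃ w s ⟩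
    2 * s + w         ∎)
  s≤0 : s ≤ 0
  s≤0 = +-cancelʳ-≤ (8 * s) _ _ (begin
    s + 8 * s         ≡⟨ e₄ s ⟩
    3 * (3 * s)       ≤⟨ *-monoʳ-≤ 3 h ⟩
    3 * (4 * w)       ≡⟨ e₅ w ⟩
    4 * (3 * w)       ≤⟨ *-monoʳ-≤ 4 3w≤2s ⟩
    4 * (2 * s)       ≡⟨ e₆ s ⟩
    0 + 8 * s         ∎)
overlap-arithmetic w s a b (suc c) _ _ _ _ _ = s≤s z≤n

-- A set of a vertices, at least 2 w - s, is at least twice as large as the degree
-- bound s - w.
haxell-arithmetic : ∀ w s a → 3 * s ≤ 4 * w → w + w ≤ a + s → (s ∸ w) + (s ∸ w) ≤ a
haxell-arithmetic w s a h ha = begin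
  (s ∸ w) + (s ∸ w)   ≡⟨ e₀ (s ∸ w) ⟩
  2 * (s ∸ w)         ≡⟨ *-distribˡ-∸ 2 s w ⟩
  2 * s ∸ 2 * w       ≤⟨ m≤n+o⇒m∸n≤o (2 * s) (2 * w) 2s≤ ⟩
  a                   ∎
  where
  open ≤-Reasoning
  e₀ : ∀ x → x + x ≡ 2 * x
  e₀ = solve-∀
  e₁ : ∀ s w → 2 * s + (s + (w + w)) ≡ 3 * s + (w + w)
  e₁ = solve-∀
  e₂ : ∀ s w a → 4 * w + (a + s) ≡ 2 * w + a + (s + (w + w))
  e₂ = solve-∀
  2s≤ : 2 * s ≤ 2 * w + a
  2s≤ = +-cancelʳ-≤ (s + (w + w)) _ _ (begin
    2 * s + (s + (w + w))       ≡⟨ e₁ s w ⟩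
    3 * s + (w + w)             ≤⟨ +-mono-≤ h ha ⟩
    4 * w + (a + s)             ≡⟨ e₂ s w a ⟩
    2 * w + a + (s + (w + w))   ∎)

-- Maximal families of disjoint sets

-- All subsets of Fin n.
allSubsets : ∀ n → List (Subset n)
allSubsets zero    = [] ∷ []
allSubsets (suc n) = map (inside ∷_) (allSubsets n) ++ map (outside ∷_) (allSubsets n)

∈-allSubsets : ∀ (p : Subset n) → p ∈ˡ allSubsets n
∈-allSubsets []            = here refl
∈-allSubsets (inside  ∷ p) = ∈-++⁺ˡ (∈-map⁺ (inside ∷_) (∈-allSubsets p))
∈-allSubsets (outside ∷ p) = ∈-++⁺ʳ _ (∈-map⁺ (outside ∷_) (∈-allSubsets p))

-- A family of pairwise disjoint members of L that every member of L meets.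
record DisjointSubfamily (L : List (Subset n)) : Set where
  field
    {size}   : ℕ
    member   : Fin size → Subset n
    ∈L       : ∀ i → member i ∈ˡ L
    disjoint : PairwiseDisjoint member
    meeting  : All (λ A → ∃[ i ] Nonempty (A ∩ member i)) L

disjointSubfamily : ∀ (L : List (Subset n)) → (∀ {A} → A ∈ˡ L → Nonempty A) → DisjointSubfamily L
disjointSubfamily [] _ = record
  { size = 0 ; member = λ () ; ∈L = λ () ; disjoint = λ { {()} } ; meeting = [] }
disjointSubfamily {n = n} (A ∷ L) inhabited
  with disjointSubfamily L (inhabited ∘ there)
... | fam with any? (λ i → nonempty? (A ∩ DisjointSubfamily.member fam i))
...   | yes meets = record
  { member   = member
  ; ∈L       = there ∘ ∈L
  ; disjoint = disjoint
  ; meeting  = meets ∷ meeting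
  }
  where open DisjointSubfamily fam
...   | no ¬meets = record
  { member   = member′
  ; ∈L       = ∈L′
  ; disjoint = disjoint′
  ; meeting  = (zero , A∩A) ∷ All.map (λ { (i , ne) → suc i , ne }) meeting
  }
  where
  open DisjointSubfamily fam
  member′ : Fin (suc size) → Subset n
  member′ zero    = A
  member′ (suc i) = member i
  ∈L′ : ∀ i → member′ i ∈ˡ A ∷ L
  ∈L′ zero    = here refl
  ∈L′ (suc i) = there (∈L i)
  disjoint′ : PairwiseDisjoint member′
  disjoint′ {zero}  {zero}  _   _   = refl
  disjoint′ {zero}  {suc j} x∈A x∈j = contradiction (j , _ , x∈p∩q⁺ (x∈A , x∈j)) ¬meets
  disjoint′ {suc i} {zero}  x∈i x∈A = contradiction (i , _ , x∈p∩q⁺ (x∈A , x∈i)) ¬meets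
  disjoint′ {suc i} {suc j} x∈i x∈j = cong suc (disjoint x∈i x∈j)
  A∩A : Nonempty (A ∩ A)
  A∩A with inhabited (here refl)
  ... | x , x∈A = x , x∈p∩q⁺ (x∈A , x∈A)

-- Maximum cliques and Hajnal's inequality

module _ (G : Graph n) where
  open Graph G

  ∈-neighbours⁺ : ∀ {v u} → v ~ u → u ∈ neighbours G v
  ∈-neighbours⁺ {v} = ∈-select⁺ (v ~?_)

  ∈-neighbours⁻ : ∀ {v u} → u ∈ neighbours G v → v ~ u
  ∈-neighbours⁻ {v} = ∈-select⁻ (v ~?_)

  degree≤Δ : ∀ v → degree G v ≤ Δ G
  degree≤Δ v = All.lookup (All.map⁻ (xs≤max 0 (map (degree G) (allFin n)))) (∈-allFin v)

  Δ≤ : ∀ {k} → (∀ v → degree G v ≤ k) → Δ G ≤ k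
  Δ≤ bound = max≤v⁺ {xs = map (degree G) (allFin n)} z≤n (All.map⁺ (All.tabulate (λ {v} _ → bound v)))

  ∣closedNbhd∣≤ : ∀ {v} {S : Subset n} → (∀ {u} → u ∈ S → v ≡ u ⊎ v ~ u) → ∣ S ∣ ≤ suc (Δ G)
  ∣closedNbhd∣≤ {v} {S} near = begin
    ∣ S ∣                           ≤⟨ p⊆q⇒∣p∣≤∣q∣ S⊆ ⟩
    ∣ ⁅ v ⁆ ∪ neighbours G v ∣      ≤⟨ ∣p∪q∣≤∣p∣+∣q∣ ⁅ v ⁆ _ ⟩
    ∣ ⁅ v ⁆ ∣ + degree G v          ≤⟨ +-mono-≤ (≤-reflexive (∣⁅x⁆∣≡1 v)) (degree≤Δ v) ⟩
    suc (Δ G)                       ∎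
    where
    open ≤-Reasoning
    S⊆ : S ⊆ ⁅ v ⁆ ∪ neighbours G v
    S⊆ u∈S with near u∈S
    ... | inj₁ refl = x∈p∪q⁺ (inj₁ (x∈⁅x⁆ v))
    ... | inj₂ v~u  = x∈p∪q⁺ (inj₂ (∈-neighbours⁺ v~u))

  clique≤ω : ∀ {S} → IsClique G S → ∣ S ∣ ≤ ω G
  clique≤ω clS = proj₂ (proj₂ (clique G)) (_ , clS , refl)

  -- A clique of the largest possible size.
  MaxClique : Subset n → Set
  MaxClique A = IsClique G A × ∣ A ∣ ≡ ω G

  largestClique : ∃[ A ] MaxClique A
  largestClique = proj₁ (proj₂ (clique G))

  maxClique? : ∀ A → Dec (MaxClique A)
  maxClique? A = isClique? G A ×-dec (∣ A ∣ ≟ⁿ ω G)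

  -- No two vertices of S are adjacent.
  Independent : Subset n → Set
  Independent S = ∀ {u v} → u ∈ S → v ∈ S → ¬ (u ~ v)

  -- Some maximum clique contains both vertices.
  Together : Fin n → Fin n → Set
  Together u v = ∃[ A ] MaxClique A × u ∈ A × v ∈ A

  together? : ∀ u v → Dec (Together u v)
  together? u v = anySubset? λ A → maxClique? A ×-dec ((u ∈? A) ×-dec (v ∈? A))

  together-sym : ∀ {u v} → Together u v → Together v u
  together-sym (A , mA , u∈A , v∈A) = A , mA , v∈A , u∈A

  together⇒near : ∀ {u v} → Together u v → u ≡ v ⊎ u ~ v
  together⇒near {u} {v} (A , (clA , _) , u∈A , v∈A) with u ≟ᶠ v
  ... | yes u≡v = inj₁ u≡v
  ... | no  u≢v = inj₂ (clA u v u∈A v∈A u≢v)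

  -- Every vertex of D shares a maximum clique with every vertex of F; this holds
  -- for the intersection and the union of a family of maximum cliques.
  Spanned : (D F : Subset n) → Set
  Spanned D F = ∀ {v u} → v ∈ D → u ∈ F → Together v u

  -- One more clique preserves the inequality |D| + |F| ≥ 2 ω, because the union
  -- of D and the trace of A on F is a clique.
  hajnal-step : ∀ {A D F} → MaxClique A → D ⊆ F → Spanned D F →
                ω G + ω G ≤ ∣ D ∣ + ∣ F ∣ → ω G + ω G ≤ ∣ A ∩ D ∣ + ∣ A ∪ F ∣
  hajnal-step {A} {D} {F} (clA , ∣A∣≡ω) D⊆F spanned =
    hajnal-arithmetic (ω G) (∣ D ∣) (∣ F ∣) (∣ A ∩ F ∣) (∣ A ∩ D ∣) (∣ A ∪ F ∣)
      (begin
        ∣ A ∩ F ∣ + ∣ D ∣                        ≡⟨ ∣p∪q∣+∣p∩q∣≡∣p∣+∣q∣ (A ∩ F) D ⟨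
        ∣ (A ∩ F) ∪ D ∣ + ∣ (A ∩ F) ∩ D ∣        ≤⟨ +-mono-≤ (clique≤ω joint) (p⊆q⇒∣p∣≤∣q∣ shrink) ⟩
        ω G + ∣ A ∩ D ∣                          ∎)
      (trans (∣p∪q∣+∣p∩q∣≡∣p∣+∣q∣ A F) (cong (_+ ∣ F ∣) ∣A∣≡ω))
    where
    open ≤-Reasoning
    shrink : (A ∩ F) ∩ D ⊆ A ∩ D
    shrink x∈ with x∈p∩q⁻ (A ∩ F) D x∈
    ... | x∈AF , x∈D = x∈p∩q⁺ (p∩q⊆p A F x∈AF , x∈D)
    near⇒adj : ∀ {u v} → u ≢ v → Together u v → u ~ v
    near⇒adj u≢v tog with together⇒near tog
    ... | inj₁ u≡v = contradiction u≡v u≢v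
    ... | inj₂ u~v = u~v
    joint : IsClique G ((A ∩ F) ∪ D)
    joint u v u∈ v∈ u≢v with x∈p∪q⁻ (A ∩ F) D u∈ | x∈p∪q⁻ (A ∩ F) D v∈
    ... | inj₁ u∈AF | inj₁ v∈AF = clA u v (p∩q⊆p A F u∈AF) (p∩q⊆p A F v∈AF) u≢v
    ... | inj₁ u∈AF | inj₂ v∈D  = ~-sym (near⇒adj (u≢v ∘ sym) (spanned v∈D (p∩q⊆q A F u∈AF)))
    ... | inj₂ u∈D  | inj₁ v∈AF = near⇒adj u≢v (spanned u∈D (p∩q⊆q A F v∈AF))
    ... | inj₂ u∈D  | inj₂ v∈D  = near⇒adj u≢v (spanned u∈D (D⊆F v∈D))

  -- Intersections of meeting maximum cliques, and a transversal of them

  -- The case ω ≥ 3/4 (Δ + 1).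
  module LargeClique (ω-large : 3 * suc (Δ G) ≤ 4 * ω G) where

    ω-positive : 0 < ω G
    ω-positive = n≢0⇒n>0 λ ω≡0 →
      n≮0 (subst (λ w → 3 * suc (Δ G) ≤ 4 * w) ω≡0 ω-large)

    maxClique-nonempty : ∀ {A} → MaxClique A → Nonempty A
    maxClique-nonempty (_ , ∣A∣≡ω) = 0<∣p∣⇒Nonempty (subst (0 <_) (sym ∣A∣≡ω) ω-positive)

    meet-large : ∀ {A B} → MaxClique A → MaxClique B → Nonempty (A ∩ B) →
                 ω G + ω G ≤ ∣ A ∩ B ∣ + suc (Δ G)
    meet-large {A} {B} mA@(_ , ∣A∣≡ω) mB@(_ , ∣B∣≡ω) (v , v∈) = begin
      ω G + ω G               ≡⟨ cong₂ _+_ ∣A∣≡ω ∣B∣≡ω ⟨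
      ∣ A ∣ + ∣ B ∣           ≡⟨ ∣p∪q∣+∣p∩q∣≡∣p∣+∣q∣ A B ⟨
      ∣ A ∪ B ∣ + ∣ A ∩ B ∣   ≤⟨ +-monoˡ-≤ ∣ A ∩ B ∣ (∣closedNbhd∣≤ near) ⟩
      suc (Δ G) + ∣ A ∩ B ∣   ≡⟨ +-comm (suc (Δ G)) ∣ A ∩ B ∣ ⟩
      ∣ A ∩ B ∣ + suc (Δ G)   ∎
      where
      open ≤-Reasoning
      near : ∀ {u} → u ∈ A ∪ B → v ≡ u ⊎ v ~ u
      near u∈ with x∈p∪q⁻ A B u∈
      ... | inj₁ u∈A = together⇒near (A , mA , p∩q⊆p A B v∈ , u∈A)
      ... | inj₂ u∈B = together⇒near (B , mB , p∩q⊆q A B v∈ , u∈B)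

    -- Two such sets X and Y each fill more than half of P.
    overlapping : ∀ {P X Y : Subset n} → ∣ P ∣ ≤ ω G → X ⊆ P → Y ⊆ P →
              ω G + ω G ≤ ∣ X ∣ + suc (Δ G) → ω G + ω G ≤ ∣ Y ∣ + suc (Δ G) →
              Nonempty (X ∩ Y)
    overlapping {P} {X} {Y} P≤ω X⊆P Y⊆P X-large Y-large = 0<∣p∣⇒Nonempty
      (overlap-arithmetic (ω G) (suc (Δ G)) (∣ X ∣) (∣ Y ∣) (∣ X ∩ Y ∣) (s≤s z≤n) ω-large
        X-large Y-large (begin
          ∣ X ∣ + ∣ Y ∣             ≡⟨ ∣p∪q∣+∣p∩q∣≡∣p∣+∣q∣ X Y ⟨
          ∣ X ∪ Y ∣ + ∣ X ∩ Y ∣     ≤⟨ +-monoˡ-≤ _ (≤-trans (p⊆q⇒∣p∣≤∣q∣ X∪Y⊆P) P≤ω) ⟩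
          ω G + ∣ X ∩ Y ∣           ∎))
      where
      open ≤-Reasoning
      X∪Y⊆P : X ∪ Y ⊆ P
      X∪Y⊆P x∈ with x∈p∪q⁻ X Y x∈
      ... | inj₁ x∈X = X⊆P x∈X
      ... | inj₂ x∈Y = Y⊆P x∈Y

    -- The core D and the hull F of Q, with L a list of maximum cliques meeting Q.
    -- The hull is the union of Q and the members of L, and the core their
    -- intersection; only the consequences used below are recorded.
    record Kernel (Q : Subset n) (L : List (Subset n)) : Set where
      field
        core hull : Subset n
        core⊆Q    : core ⊆ Q
        Q⊆hull    : Q ⊆ hull
        core⊆     : All (core ⊆_) L
        spanned   : Spanned core hull
        hajnal    : ω G + ω G ≤ ∣ core ∣ + ∣ hull ∣
        inhabited : Nonempty core

      hull≤Δ+1 : ∣ hull ∣ ≤ suc (Δ G)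
      hull≤Δ+1 = ∣closedNbhd∣≤ (λ u∈ → together⇒near (spanned (proj₂ inhabited) u∈))

      core-large : ω G + ω G ≤ ∣ core ∣ + suc (Δ G)
      core-large = ≤-trans hajnal (+-monoʳ-≤ ∣ core ∣ hull≤Δ+1)

    -- Kostochka's lemma, with Hajnal's inequality carried through the induction.
    kernel : ∀ {Q} → MaxClique Q → ∀ L → All (λ A → MaxClique A × Nonempty (A ∩ Q)) L → Kernel Q L
    kernel {Q} mQ [] [] = record
      { core      = Q
      ; hull      = Q
      ; core⊆Q    = λ x∈ → x∈
      ; Q⊆hull    = λ x∈ → x∈
      ; core⊆     = []
      ; spanned   = λ v∈Q u∈Q → Q , mQ , v∈Q , u∈Q
      ; hajnal    = ≤-reflexive (cong₂ _+_ (sym (proj₂ mQ)) (sym (proj₂ mQ)))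
      ; inhabited = maxClique-nonempty mQ
      }
    kernel {Q} mQ (A ∷ L) ((mA , A∩Q) ∷ ms) = record
      { core      = A ∩ core
      ; hull      = A ∪ hull
      ; core⊆Q    = core⊆Q ∘ p∩q⊆q A core
      ; Q⊆hull    = q⊆p∪q A hull ∘ Q⊆hull
      ; core⊆     = p∩q⊆p A core ∷ All.map (λ c⊆ {_} x∈ → c⊆ (p∩q⊆q A core x∈)) core⊆
      ; spanned   = spanned′
      ; hajnal    = hajnal-step mA (Q⊆hull ∘ core⊆Q) spanned hajnal
      ; inhabited = inhabited′
      }
      where
      open Kernel (kernel mQ L ms)
      spanned′ : Spanned (A ∩ core) (A ∪ hull)
      spanned′ v∈ u∈ with x∈p∩q⁻ A core v∈ | x∈p∪q⁻ A hull u∈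
      ... | v∈A , _  | inj₁ u∈A = A , mA , v∈A , u∈A
      ... | _ , v∈c  | inj₂ u∈h = spanned v∈c u∈h
      -- Both the trace of A on Q and the core so far fill more than half of Q.
      inhabited′ : Nonempty (A ∩ core)
      inhabited′ with overlapping {P = Q} {A ∩ Q} {core} (≤-reflexive (proj₂ mQ)) (p∩q⊆q A Q) core⊆Q
                        (meet-large mA mQ A∩Q) core-large
      ... | x , x∈ with x∈p∩q⁻ (A ∩ Q) core x∈
      ...   | x∈AQ , x∈c = x , x∈p∩q⁺ (p∩q⊆p A Q x∈AQ , x∈c)

    maxCliques : List (Subset n)
    maxCliques = filter maxClique? (allSubsets n)

    ∈-maxCliques⁺ : ∀ {A} → MaxClique A → A ∈ˡ maxCliques
    ∈-maxCliques⁺ {A} = ∈-filter⁺ maxClique? (∈-allSubsets A)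

    ∈-maxCliques⁻ : ∀ {A} → A ∈ˡ maxCliques → MaxClique A
    ∈-maxCliques⁻ A∈ = proj₂ (∈-filter⁻ maxClique? {xs = allSubsets n} A∈)

    maxCliquesMeeting : Subset n → List (Subset n)
    maxCliquesMeeting Q = filter (λ A → nonempty? (A ∩ Q)) maxCliques

    kernelOf : ∀ {Q} → MaxClique Q → Kernel Q (maxCliquesMeeting Q)
    kernelOf {Q} mQ = kernel mQ (maxCliquesMeeting Q) (All.tabulate λ A∈ →
      let A∈max , meets = ∈-filter⁻ (λ A → nonempty? (A ∩ Q)) {xs = maxCliques} A∈
      in ∈-maxCliques⁻ A∈max , meets)

    core⊆meeting : ∀ {A Q} (K : Kernel Q (maxCliquesMeeting Q)) → MaxClique A → Nonempty (A ∩ Q) →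
                   Kernel.core K ⊆ A
    core⊆meeting {A} {Q} K mA meets = All.lookup (Kernel.core⊆ K)
      (∈-filter⁺ (λ A → nonempty? (A ∩ Q)) (∈-maxCliques⁺ mA) meets)

    -- Adjacent vertices sharing no maximum clique.
    _⊥~_ : Fin n → Fin n → Set
    u ⊥~ v = u ~ v × ¬ Together u v

    _⊥~?_ : ∀ u v → Dec (u ⊥~ v)
    u ⊥~? v = (u ~? v) ×-dec ¬? (together? u v)

    ⊥~-sym : ∀ {u v} → u ⊥~ v → v ⊥~ u
    ⊥~-sym (u~v , ¬tog) = ~-sym u~v , ¬tog ∘ together-sym

    open Transversals _⊥~?_ ⊥~-sym

    -- A family of pairwise disjoint maximum cliques with their kernels.
    module _ {r} {Q : Fin r → Subset n} (Q-max : ∀ i → MaxClique (Q i))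
      (Q-disjoint : PairwiseDisjoint Q) (kernels : ∀ i → Kernel (Q i) (maxCliquesMeeting (Q i)))
      where

      private module K i = Kernel (kernels i)

      core-disjoint : PairwiseDisjoint K.core
      core-disjoint {i} {j} x∈ y∈ = Q-disjoint (K.core⊆Q i x∈) (K.core⊆Q j y∈)

      -- The neighbours counted lie outside the hull, which has at least ω vertices
      -- of the closed neighbourhood of v.
      core-sparse : ∀ {i v} → v ∈ K.core i → ∣ nbrs v ∣ ≤ suc (Δ G) ∸ ω G
      core-sparse {i} {v} v∈ = m+n≤o⇒m≤o∸n ∣ nbrs v ∣ {ω G} {suc (Δ G)} (begin
        ∣ nbrs v ∣ + ω G                 ≡⟨ cong (∣ nbrs v ∣ +_) (proj₂ (Q-max i)) ⟨
        ∣ nbrs v ∣ + ∣ Q i ∣             ≤⟨ +-monoʳ-≤ ∣ nbrs v ∣ (p⊆q⇒∣p∣≤∣q∣ (K.Q⊆hull i)) ⟩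
        ∣ nbrs v ∣ + ∣ K.hull i ∣        ≡⟨ ∣p∪q∣≡∣p∣+∣q∣ (nbrs v) _ separate ⟨
        ∣ nbrs v ∪ K.hull i ∣            ≤⟨ ∣closedNbhd∣≤ near ⟩
        suc (Δ G)                        ∎)
        where
        open ≤-Reasoning
        separate : Empty (nbrs v ∩ K.hull i)
        separate (u , u∈) with x∈p∩q⁻ (nbrs v) (K.hull i) u∈
        ... | u∈N , u∈F = proj₂ (∈-select⁻ (v ⊥~?_) u∈N) (K.spanned i v∈ u∈F)
        near : ∀ {u} → u ∈ nbrs v ∪ K.hull i → v ≡ u ⊎ v ~ u
        near u∈ with x∈p∪q⁻ (nbrs v) (K.hull i) u∈
        ... | inj₁ u∈N = inj₂ (proj₁ (∈-select⁻ (v ⊥~?_) u∈N))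
        ... | inj₂ u∈F = together⇒near (K.spanned i v∈ u∈F)

      -- A maximum clique containing both vertices contains both cores, which would
      -- then overlap.
      together⇒≡ : ∀ {i j u v} → u ∈ K.core i → v ∈ K.core j → Together u v → i ≡ j
      together⇒≡ {i} {j} u∈ v∈ (A , mA , u∈A , v∈A)
        with overlapping {P = A} {K.core i} {K.core j} (≤-reflexive (proj₂ mA))
               (core⊆meeting (kernels i) mA (_ , x∈p∩q⁺ (u∈A , K.core⊆Q i u∈)))
               (core⊆meeting (kernels j) mA (_ , x∈p∩q⁺ (v∈A , K.core⊆Q j v∈)))
               (K.core-large i) (K.core-large j)
      ... | x , x∈ with x∈p∩q⁻ (K.core i) (K.core j) x∈
      ...   | x∈i , x∈j = core-disjoint {i} {j} x∈i x∈j

      core-transversal : ∃[ t ] IsIT K.core t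
      core-transversal = haxell K.core core-disjoint (suc (Δ G) ∸ ω G) core-sparse
        (λ i → haxell-arithmetic (ω G) (suc (Δ G)) ∣ K.core i ∣ ω-large (K.core-large i))
        K.inhabited

      core-transversal-independent : ∀ {t} → IsIT K.core t → ∀ {i j} → ¬ (t i ~ t j)
      core-transversal-independent (t∈core , t-indep) {i} {j} ti~tj with i ≟ᶠ j
      ... | yes refl = ~-irrefl ti~tj
      ... | no  i≢j  = t-indep i≢j (ti~tj , i≢j ∘ together⇒≡ (t∈core i) (t∈core j))

    -- The transversal consists of one vertex from the core of each member of a
    -- maximal disjoint family of maximum cliques.
    independent-hitting : ∃[ I ] Independent I × (∀ {A} → MaxClique A → Nonempty (A ∩ I))
    independent-hitting = select inI? , independent , hit
      where
      open DisjointSubfamily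
        (disjointSubfamily maxCliques (maxClique-nonempty ∘ ∈-maxCliques⁻))
        renaming (member to Q)
      Q-max : ∀ i → MaxClique (Q i)
      Q-max i = ∈-maxCliques⁻ (∈L i)
      kernels : ∀ i → Kernel (Q i) (maxCliquesMeeting (Q i))
      kernels i = kernelOf (Q-max i)
      transversal = core-transversal Q-max disjoint kernels
      t = proj₁ transversal
      inI? : ∀ v → Dec (∃[ i ] t i ≡ v)
      inI? v = any? (λ i → t i ≟ᶠ v)
      independent : Independent (select inI?)
      independent u∈ v∈ u~v =
        let i , ti≡u = ∈-select⁻ inI? u∈
            j , tj≡v = ∈-select⁻ inI? v∈
        in core-transversal-independent Q-max disjoint kernels (proj₂ transversal) {i} {j}
             (subst₂ _~_ (sym ti≡u) (sym tj≡v) u~v)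
      hit : ∀ {A} → MaxClique A → Nonempty (A ∩ select inI?)
      hit {A} mA =
        let i , meets = All.lookup meeting (∈-maxCliques⁺ mA)
            ti∈core   = proj₁ (proj₂ transversal) i
        in t i , x∈p∩q⁺ (core⊆meeting (kernels i) mA meets ti∈core , ∈-select⁺ inI? (i , refl))

-- Induced subgraphs

-- The increasing enumeration of S.
emb : (S : Subset n) → Fin ∣ S ∣ → Fin n
emb (outside ∷ S) i       = suc (emb S i)
emb (inside  ∷ S) zero    = zero
emb (inside  ∷ S) (suc i) = suc (emb S i)

emb-∈ : ∀ (S : Subset n) i → emb S i ∈ S
emb-∈ (outside ∷ S) i       = there (emb-∈ S i)
emb-∈ (inside  ∷ S) zero    = here
emb-∈ (inside  ∷ S) (suc i) = there (emb-∈ S i)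

-- The position of a member of S in the enumeration.
index : ∀ {S : Subset n} {v} → v ∈ S → Fin ∣ S ∣
index {S = inside  ∷ S} here        = zero
index {S = inside  ∷ S} (there v∈S) = suc (index v∈S)
index {S = outside ∷ S} (there v∈S) = index v∈S

emb-index : ∀ {S : Subset n} {v} (v∈S : v ∈ S) → emb S (index v∈S) ≡ v
emb-index {S = inside  ∷ S} here        = refl
emb-index {S = inside  ∷ S} (there v∈S) = cong suc (emb-index v∈S)
emb-index {S = outside ∷ S} (there v∈S) = cong suc (emb-index v∈S)

-- The image of T under emb S.
image : (S : Subset n) → Subset ∣ S ∣ → Subset n
image []            T       = []
image (outside ∷ S) T       = outside ∷ image S T
image (inside  ∷ S) (b ∷ T) = b ∷ image S T

∣image∣ : ∀ (S : Subset n) T → ∣ image S T ∣ ≡ ∣ T ∣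
∣image∣ []            []            = refl
∣image∣ (outside ∷ S) T             = ∣image∣ S T
∣image∣ (inside  ∷ S) (inside  ∷ T) = cong suc (∣image∣ S T)
∣image∣ (inside  ∷ S) (outside ∷ T) = ∣image∣ S T

∈-image⁻ : ∀ (S : Subset n) T {v} → v ∈ image S T → ∃[ i ] emb S i ≡ v × i ∈ T
∈-image⁻ (outside ∷ S) T (there v∈) with ∈-image⁻ S T v∈
... | i , refl , i∈T = i , refl , i∈T
∈-image⁻ (inside ∷ S) (b ∷ T) here = zero , refl , here
∈-image⁻ (inside ∷ S) (b ∷ T) (there v∈) with ∈-image⁻ S T v∈
... | i , refl , i∈T = suc i , refl , there i∈T

-- The subgraph induced by S, its vertices numbered by emb S.
induced : Graph n → (S : Subset n) → Graph ∣ S ∣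
induced G S = record
  { _~_      = λ i j → emb S i ~ emb S j
  ; _~?_     = λ i j → emb S i ~? emb S j
  ; ~-sym    = ~-sym
  ; ~-irrefl = ~-irrefl
  }
  where open Graph G

-- Deleting a maximal independent set

maximalIndependent : ∀ (G : Graph n) (I : Subset n) → Independent G I →
  ∃[ M ] I ⊆ M × Independent G M × (∀ v → v ∉ M → ∃[ u ] u ∈ M × Graph._~_ G v u)
maximalIndependent {n} G I I-indep = grow n I (λ x∈ → x∈) I-indep (m≤m+n n ∣ I ∣)
  where
  open Graph G
  -- Vertices without neighbours in M are added; the fuel bounds their number.
  grow : ∀ fuel M → I ⊆ M → Independent G M → n ≤ fuel + ∣ M ∣ →
         ∃[ M′ ] I ⊆ M′ × Independent G M′ × (∀ v → v ∉ M′ → ∃[ u ] u ∈ M′ × v ~ u)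
  grow fuel M I⊆M M-indep size
    with any? (λ v → ¬? (v ∈? M) ×-dec ¬? (any? λ u → (u ∈? M) ×-dec (v ~? u)))
  ... | no none = M , I⊆M , M-indep , dominated
    where
    dominated : ∀ v → v ∉ M → ∃[ u ] u ∈ M × v ~ u
    dominated v v∉M with any? (λ u → (u ∈? M) ×-dec (v ~? u))
    ... | yes found = found
    ... | no  ¬any  = contradiction (v , v∉M , ¬any) none
  grow zero M I⊆M M-indep size | yes (v , v∉M , _) =
    contradiction (subst (v ∈_) (sym (∣p∣≡n⇒p≡⊤ (≤-antisym (∣p∣≤n M) size))) ∈⊤) v∉M
  grow (suc fuel) M I⊆M M-indep size | yes (v , v∉M , apart) =
    grow fuel (M ∪ ⁅ v ⁆) (p⊆p∪q ⁅ v ⁆ ∘ I⊆M) indep (begin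
      n                         ≤⟨ size ⟩
      suc fuel + ∣ M ∣          ≡⟨ +-suc fuel ∣ M ∣ ⟨
      fuel + suc ∣ M ∣          ≤⟨ +-monoʳ-≤ fuel (p⊂q⇒∣p∣<∣q∣
                                     (p⊆p∪q ⁅ v ⁆ , v , x∈p∪q⁺ (inj₂ (x∈⁅x⁆ v)) , v∉M)) ⟩
      fuel + ∣ M ∪ ⁅ v ⁆ ∣      ∎)
    where
    open ≤-Reasoning
    indep : Independent G (M ∪ ⁅ v ⁆)
    indep x∈ y∈ x~y with x∈p∪q⁻ M ⁅ v ⁆ x∈ | x∈p∪q⁻ M ⁅ v ⁆ y∈
    ... | inj₁ x∈M | inj₁ y∈M = M-indep x∈M y∈M x~y
    ... | inj₁ x∈M | inj₂ y∈v with x∈⁅y⁆⇒x≡y v y∈v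
    ...   | refl = apart (_ , x∈M , ~-sym x~y)
    indep x∈ y∈ x~y | inj₂ x∈v | inj₁ y∈M with x∈⁅y⁆⇒x≡y v x∈v
    ...   | refl = apart (_ , y∈M , x~y)
    indep x∈ y∈ x~y | inj₂ x∈v | inj₂ y∈v with x∈⁅y⁆⇒x≡y v x∈v | x∈⁅y⁆⇒x≡y v y∈v
    ...   | refl | refl = ~-irrefl x~y

χ≤ : ∀ (G : Graph n) {k} → Colourable G k → χ G ≤ k
χ≤ G = proj₂ (proj₂ (chromatic G))

module _ (G : Graph n) (M : Subset n) (M-indep : Independent G M) where
  open Graph G

  -- The graph G - M.
  rest : Graph ∣ ∁ M ∣
  rest = induced G (∁ M)

  -- The independent set M takes one new colour.
  χ≤1+χ-rest : χ G ≤ suc (χ rest)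
  χ≤1+χ-rest = χ≤ G (extended , proper)
    where
    c = proj₁ (proj₁ (proj₂ (chromatic rest)))
    c-proper = proj₂ (proj₁ (proj₂ (chromatic rest)))
    extended : Fin n → Fin (suc (χ rest))
    extended v with v ∈? M
    ... | yes _   = zero
    ... | no  v∉M = suc (c (index (x∉p⇒x∈∁p v∉M)))
    proper : IsProperColouring G extended
    proper u v u~v with u ∈? M | v ∈? M
    ... | yes u∈M | yes v∈M = λ _ → M-indep u∈M v∈M u~v
    ... | yes _   | no  _   = λ ()
    ... | no  _   | yes _   = λ ()
    ... | no u∉M  | no v∉M  = c-proper _ _
      (subst₂ _~_ (sym (emb-index (x∉p⇒x∈∁p u∉M))) (sym (emb-index (x∉p⇒x∈∁p v∉M))) u~v)
      ∘ sucᶠ-injective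

  ω-rest<ω : (∀ {A} → MaxClique G A → Nonempty (A ∩ M)) → ω rest < ω G
  ω-rest<ω hit = ≤∧≢⇒< (subst (_≤ ω G) ∣A∣≡ (clique≤ω G clA))
                       (λ eq → missed (hit (clA , trans ∣A∣≡ eq)))
    where
    T : Subset ∣ ∁ M ∣
    T = proj₁ (largestClique rest)
    clT : IsClique rest T
    clT = proj₁ (proj₂ (largestClique rest))
    A : Subset n
    A = image (∁ M) T
    ∣A∣≡ : ∣ A ∣ ≡ ω rest
    ∣A∣≡ = trans (∣image∣ (∁ M) T) (proj₂ (proj₂ (largestClique rest)))
    clA : IsClique G A
    clA u v u∈ v∈ u≢v with ∈-image⁻ (∁ M) T u∈ | ∈-image⁻ (∁ M) T v∈
    ... | i , refl , i∈T | j , refl , j∈T = clT i j i∈T j∈T (u≢v ∘ cong (emb (∁ M)))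
    missed : Empty (A ∩ M)
    missed (v , v∈) with x∈p∩q⁻ A M v∈
    ... | v∈A , v∈M with ∈-image⁻ (∁ M) T v∈A
    ...   | i , refl , _ = x∈∁p⇒x∉p (emb-∈ (∁ M) i) v∈M

  -- Every vertex outside M has a neighbour in M, which the deletion removes.
  degree-rest<Δ : (∀ v → v ∉ M → ∃[ u ] u ∈ M × v ~ u) → ∀ i → degree rest i < Δ G
  degree-rest<Δ dominated i with dominated (emb (∁ M) i) (x∈∁p⇒x∉p (emb-∈ (∁ M) i))
  ... | w , w∈M , v~w = ≤-trans
    (subst (_< degree G v) (∣image∣ (∁ M) (neighbours rest i))
      (p⊂q⇒∣p∣<∣q∣ (inc , w , ∈-neighbours⁺ G v~w , w∉)))
    (degree≤Δ G v)
    where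
    v : Fin n
    v = emb (∁ M) i
    inc : image (∁ M) (neighbours rest i) ⊆ neighbours G v
    inc u∈ with ∈-image⁻ (∁ M) (neighbours rest i) u∈
    ... | j , refl , j∈ = ∈-neighbours⁺ G (∈-neighbours⁻ rest j∈)
    w∉ : w ∉ image (∁ M) (neighbours rest i)
    w∉ w∈ with ∈-image⁻ (∁ M) (neighbours rest i) w∈
    ... | j , refl , _ = x∈∁p⇒x∉p (emb-∈ (∁ M) j) w∈M

Δ≡0⇒χ≤1 : ∀ (G : Graph n) → Δ G ≡ 0 → χ G ≤ 1
Δ≡0⇒χ≤1 G Δ≡0 = χ≤ G ((λ _ → zero) , λ u v u~v _ →
  n≮0 (subst (0 <_) Δ≡0 (≤-trans (x∈p⇒0<∣p∣ (∈-neighbours⁺ G u~v)) (degree≤Δ G u))))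

-- Reed's bound

⌈⌉-step : ∀ w d → suc ⌈ w + d + 1 /2⌉ ≡ ⌈ suc w + suc d + 1 /2⌉
⌈⌉-step w d = cong ⌈_/2⌉ (e w d)
  where
  e : ∀ w d → suc (suc (w + d + 1)) ≡ suc w + suc d + 1
  e = solve-∀

-- Reed's bound holds for G if it holds for all smaller graphs and some
-- independent set hits every maximum clique. That set is first made maximal, so
-- that deleting it lowers every degree as well as ω.
reed-step : ∀ (G : Graph n) → (∀ {m} → m < n → (H : Graph m) → χ H ≤ reedBound H) →
  (∃[ I ] Independent G I × (∀ {A} → MaxClique G A → Nonempty (A ∩ I))) → χ G ≤ reedBound G
reed-step {n} G minimal (I , I-indep , I-hits) = by-Δ (Δ G) refl
  where
  open ≤-Reasoning
  extension = maximalIndependent G I I-indep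
  M : Subset n
  M = proj₁ extension
  M-indep : Independent G M
  M-indep = proj₁ (proj₂ (proj₂ extension))
  H : Graph ∣ ∁ M ∣
  H = rest G M M-indep
  hits : ∀ {A} → MaxClique G A → Nonempty (A ∩ M)
  hits {A} mA =
    let v , v∈    = I-hits mA
        v∈A , v∈I = x∈p∩q⁻ A I v∈
    in v , x∈p∩q⁺ (v∈A , proj₁ (proj₂ extension) v∈I)
  fewer : ∣ ∁ M ∣ < n
  fewer =
    let A , mA = largestClique G
        v , v∈ = hits mA
    in subst (∣ ∁ M ∣ <_) (∣⊤∣≡n n)
         (p⊂q⇒∣p∣<∣q∣ (⊆⊤ , v , ∈⊤ , λ v∈∁ → x∈∁p⇒x∉p v∈∁ (p∩q⊆q A M v∈)))
  -- Without edges the deletion cannot lower Δ, but then one colour is enough.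
  by-Δ : ∀ k → Δ G ≡ k → χ G ≤ reedBound G
  by-Δ zero    Δ≡0 = ≤-trans (Δ≡0⇒χ≤1 G Δ≡0) (⌈n/2⌉-mono (m≤n+m 1 (ω G + Δ G)))
  by-Δ (suc d) Δ≡  = begin
    χ G                                           ≤⟨ χ≤1+χ-rest G M M-indep ⟩
    suc (χ H)                                     ≤⟨ s≤s (minimal fewer H) ⟩
    suc ⌈ ω H + Δ H + 1 /2⌉                       ≡⟨ ⌈⌉-step (ω H) (Δ H) ⟩
    ⌈ suc (ω H) + suc (Δ H) + 1 /2⌉               ≤⟨ ⌈n/2⌉-mono (+-monoˡ-≤ 1
                                                      (+-mono-≤ (ω-rest<ω G M M-indep hits) Δ<)) ⟩
    ⌈ ω G + Δ G + 1 /2⌉                           ∎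
    where
    Δ< : Δ H < Δ G
    Δ< = subst (Δ H <_) (sym Δ≡) (s≤s (Δ≤ H λ v → s≤s⁻¹ (subst (degree H v <_) Δ≡
      (degree-rest<Δ G M M-indep (proj₂ (proj₂ (proj₂ extension))) v))))

ω-bound : ∀ (G : Graph n) → IsMinimumCounterexample G → 4 * ω G < 3 * suc (Δ G)
ω-bound G (χ>bound , minimal) = ≰⇒> λ ω-large →
  <⇒≱ χ>bound (reed-step G minimal (LargeClique.independent-hitting G ω-large))

-- Integer and rational forms of the inequalities

open import Data.Integer.Base as ℤ using (+_)
import Data.Integer.DivMod as ℤ
import Data.Integer.Properties as ℤ
open import Data.Rational.Unnormalised.Base as ℚᵘ using (_/_; ceiling)

k≤⌈k/2⌉+⌈k/2⌉ : ∀ k → k ≤ ⌈ k /2⌉ + ⌈ k /2⌉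
k≤⌈k/2⌉+⌈k/2⌉ k = ≤-trans (≤-reflexive (sym (⌊n/2⌋+⌈n/2⌉≡n k))) (+-monoˡ-≤ ⌈ k /2⌉ (⌊n/2⌋≤⌈n/2⌉ k))

7w≤6⌈w+d+1/2⌉ : ∀ w d → 4 * w < 3 * suc d → 7 * w ≤ 6 * ⌈ w + d + 1 /2⌉
7w≤6⌈w+d+1/2⌉ w d h = begin
  7 * w                     ≡⟨ e₁ w ⟩
  3 * w + 4 * w             ≤⟨ +-monoʳ-≤ (3 * w) (<⇒≤ h) ⟩
  3 * w + 3 * suc d         ≡⟨ e₂ w d ⟩
  3 * (w + d + 1)           ≤⟨ *-monoʳ-≤ 3 (k≤⌈k/2⌉+⌈k/2⌉ (w + d + 1)) ⟩
  3 * (R + R)               ≡⟨ e₃ R ⟩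
  6 * R                     ∎
  where
  open ≤-Reasoning
  R = ⌈ w + d + 1 /2⌉
  e₁ : ∀ w → 7 * w ≡ 3 * w + 4 * w
  e₁ = solve-∀
  e₂ : ∀ w d → 3 * w + 3 * suc d ≡ 3 * (w + d + 1)
  e₂ = solve-∀
  e₃ : ∀ x → 3 * (x + x) ≡ 6 * x
  e₃ = solve-∀

⌈7/6*w⌉≤ : ∀ w c → 7 * w ≤ 6 * c → ceiling ((+ 7 / 6) ℚᵘ.* toℚᵘ w) ℤ.≤ + c
⌈7/6*w⌉≤ w c h = subst (ℤ.- q ℤ.≤_) (ℤ.neg-involutive (+ c)) (ℤ.neg-mono-≤ -c≤q)
  where
  N q : ℤ.ℤ
  N = ℤ.- (+ 7 ℤ.* + w)
  q = N ℤ./ + 6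
  open ℤ.≤-Reasoning
  -c<1+q : ℤ.- + c ℤ.< ℤ.suc q
  -c<1+q = ℤ.*-cancelʳ-<-nonNeg (+ 6) (begin-strict
    ℤ.- + c ℤ.* + 6              ≡⟨ ℤ.neg-distribˡ-* (+ c) (+ 6) ⟨
    ℤ.- (+ c ℤ.* + 6)            ≡⟨ cong ℤ.-_ (trans (ℤ.*-comm (+ c) (+ 6)) (sym (ℤ.pos-* 6 c))) ⟩
    ℤ.- + (6 * c)                ≤⟨ ℤ.neg-mono-≤ (ℤ.+≤+ h) ⟩
    ℤ.- + (7 * w)                ≡⟨ cong ℤ.-_ (ℤ.pos-* 7 w) ⟩
    N                            <⟨ ℤ.n<s[n/ℕd]*d N 6 ⟩
    ℤ.suc (N ℤ./ℕ 6) ℤ.* + 6     ≡⟨ cong (λ k → ℤ.suc k ℤ.* + 6) (ℤ.div-pos-is-/ℕ N 6) ⟨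
    ℤ.suc q ℤ.* + 6              ∎)
  -c≤q : ℤ.- + c ℤ.≤ q
  -c≤q = subst (ℤ.- + c ℤ.≤_) (ℤ.pred-suc q) (ℤ.i<j⇒i≤pred[j] -c<1+q)

w<¾*[d+1] : ∀ w d → 4 * w < 3 * suc d → toℚᵘ w ℚᵘ.< (+ 3 / 4) ℚᵘ.* toℚᵘ (d + 1)
w<¾*[d+1] w d h = ℚᵘ.*<* (subst₂ ℤ._<_ lhs rhs (ℤ.+<+ h))
  where
  lhs : + (4 * w) ≡ + w ℤ.* + 4
  lhs = trans (cong +_ (*-comm 4 w)) (ℤ.pos-* w 4)
  rhs : + (3 * suc d) ≡ + 3 ℤ.* + (d + 1) ℤ.* + 1
  rhs = trans (cong (λ k → + (3 * k)) (+-comm 1 d))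
          (trans (ℤ.pos-* 3 (d + 1)) (sym (ℤ.*-identityʳ _)))

mainTheorem3 : ∀ {n : ℕ} (G : Graph n) → IsMinimumCounterexample G →
    (toℚᵘ (ω G) ℚᵘ.< (+ 3 / 4) ℚᵘ.* toℚᵘ (Δ G + 1))
    × (+ χ G ℤ.> ceiling ((+ 7 / 6) ℚᵘ.* toℚᵘ (ω G)))
mainTheorem3 G mc@(χ>bound , _) =
  w<¾*[d+1] (ω G) (Δ G) (ω-bound G mc) ,
  ℤ.≤-<-trans (⌈7/6*w⌉≤ (ω G) (reedBound G) (7w≤6⌈w+d+1/2⌉ (ω G) (Δ G) (ω-bound G mc))) (ℤ.+<+ χ>bound)
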